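{- Let $z_1=(x_1,y_1)$, $z_2=(x_2,y_2)$, $z_3=(x_3,y_3)$ be distinct points of $\mathbb{Z}^2$, let $d\ge d_3(z_1,z_2,z_3)$ be an integer and $c=d-d_3(z_1,z_2,z_3)$. Define $\alpha_1=\max\{\min\{x_1,x_2\},\min\{x_1,x_3\}\}$, $\beta_1=\min\{\max\{x_1,x_2\},\max\{x_1,x_3\}\}$, $\gamma_1=\max\{\min\{y_1,y_2\},\min\{y_1,y_3\}\}$, $\delta_1=\min\{\max\{y_1,y_2\},\max\{y_1,y_3\}\}$; $\alpha_2=\max\{\min\{x_1,x_2\},\min\{x_2,x_3\}\}$, $\beta_2=\min\{\max\{x_1,x_2\},\max\{x_2,x_3\}\}$, $\gamma_2=\max\{\min\{y_1,y_2\},\min\{y_2,y_3\}\}$, $\delta_2=\min\{\max\{y_1,y_2\},\max\{y_2,y_3\}\}$; $\alpha_3=\max\{\min\{x_1,x_3\},\min\{x_2,x_3\}\}$, $\beta_3=\min\{\max\{x_1,x_3\},\max\{x_2,x_3\}\}$, $\gamma_3=\max\{\min\{y_1,y_3\},\min\{y_2,y_3\}\}$, $\delta_3=\min\{\max\{y_1,y_3\},\max\{y_2,y_3\}\}$. Then the set ${\cal A}_d(z_1,z_2,z_3)=\{z\in\mathbb{Z}^2: d_4(z_1,z_2,z_3,z)\le d\}$ equals ${\mathscr O}_1\cup{\mathscr O}_2\cup{\mathscr O}_3$, where for $i=1,2,3$, ${\mathscr O}_i$ is the set of $(x,y)\in\mathbb{Z}^2$ with $\alpha_i-c\le x\le\beta_i+c$,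 $\gamma_i-c\le y\le\delta_i+c$, $\alpha_i+\gamma_i-c\le x+y\le\beta_i+\delta_i+c$, $\alpha_i-\delta_i-c\le x-y\le\beta_i-\gamma_i+c$.
   Context: The grid graph ${\cal G}_2$ has vertex set $\mathbb{Z}^2$, with $z,z'$ adjacent iff their $L_1$-distance is $1$. The tristance $d_3(z_1,z_2,z_3)$ (resp. quadristance $d_4(z_1,z_2,z_3,z_4)$) of points of $\mathbb{Z}^2$ is the minimum number of edges of a tree in ${\cal G}_2$ (possibly using additional vertices) containing the three (resp. four) given points. -}

module Defs where

open import Data.Nat as ℕ using (ℕ; suc)
open import Data.Integer using (ℤ; +_; _-_; _+_; _≤_; _⊓_; _⊔_; ∣_∣)
open import Data.Product using (_×_; _,_; ∃; Σ)
open import Data.List using (List; []; _∷_; length)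
open import Data.List.Relation.Unary.Any using (Any)
open import Data.List.Relation.Unary.All using (All)
open import Data.List.Membership.Propositional using (_∈_; _∉_)
open import Relation.Binary.PropositionalEquality using (_≡_)

Point : Set
Point = ℤ × ℤ

xc : Point → ℤ
xc (x , _) = x

yc : Point → ℤ
yc (_ , y) = y

Adj : Point → Point → Set
Adj (x , y) (x' , y') = ∣ x - x' ∣ ℕ.+ ∣ y - y' ∣ ≡ 1

-- A finite tree in G₂, given by its vertex list, built by the standard
-- recursive construction: a single vertex, or a tree extended by a new leaf
-- v (not already a vertex) joined by an edge to an existing vertex.
-- A tree with vertex list vs has (length vs - 1) edges.
data GridTree : List Point → Set where
  single : ∀ v → GridTree (v ∷ [])
  grow   : ∀ {vs} v → GridTree vs → v ∉ vs → Any (Adj v) vs → GridTree (v ∷ vs)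

TreeWithin : ℕ → List Point → Set
TreeWithin k zs =
  Σ (List Point) λ vs → GridTree vs × (length vs ℕ.≤ suc k) × All (_∈ vs) zs

IsTristance : Point → Point → Point → ℕ → Set
IsTristance z₁ z₂ z₃ t =
  TreeWithin t (z₁ ∷ z₂ ∷ z₃ ∷ []) ×
  (∀ k → TreeWithin k (z₁ ∷ z₂ ∷ z₃ ∷ []) → t ℕ.≤ k)

Quadristance≤ : Point → Point → Point → Point → ℕ → Set
Quadristance≤ z₁ z₂ z₃ z d = TreeWithin d (z₁ ∷ z₂ ∷ z₃ ∷ z ∷ [])

InOct : ℤ → ℤ → ℤ → ℤ → ℤ → Point → Set
InOct α β γ δ c (x , y) =
  (α - c ≤ x × x ≤ β + c) ×
  (γ - c ≤ y × y ≤ δ + c) ×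
  (α + γ - c ≤ x + y × x + y ≤ β + δ + c) ×
  (α - δ - c ≤ x - y × x - y ≤ β - γ + c)

-- 𝒪ᵢ for the point zᵢ relative to zⱼ, zₖ (the other two points):
-- αᵢ = max{min{xᵢ,xⱼ},min{xᵢ,xₖ}} etc.
-- Note: the paper's formulas for i = 1,2,3 are all of this symmetric form
-- (with the pair order irrelevant since max/min are commutative).
Oct : Point → Point → Point → ℤ → Point → Set
Oct (xi , yi) (xj , yj) (xk , yk) c =
  InOct ((xi ⊓ xj) ⊔ (xi ⊓ xk)) ((xi ⊔ xj) ⊓ (xi ⊔ xk))
        ((yi ⊓ yj) ⊔ (yi ⊓ yk)) ((yi ⊔ yj) ⊓ (yi ⊔ yk)) c

{-# OPTIONS --safe #-}

-- Let m be the coordinatewise median of z₁, z₂, z₃. Then d₃ is the sum of the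
-- distances from m to the zᵢ, and 𝒪ᵢ is the L₁-ball of radius c around the
-- rectangle spanned by zᵢ and m. If z is at distance e from the point s of that
-- rectangle, a shortest tree through z₁, z₂, z₃ can be routed through s and
-- extended by e edges. Conversely, a tree through z₁, z₂, z₃, z has two branching
-- points q and p such that z and some zᵢ hang off q and the other two off p; its
-- size is at least the total length of these five paths, and this bound
-- splits into one-dimensional inequalities for the two coordinates.
module Submission where

open import Defs
open import Data.Nat using (ℕ; _≤_; _∸_)
open import Data.Integer using (+_)
open import Data.Product using (_×_)
open import Data.Sum using (_⊎_)
open import Relation.Binary.PropositionalEquality using (_≢_)

open import Data.Nat using (zero; suc; _+_; _<_; z≤n; s≤s; s≤s⁻¹)
import Data.Nat.Properties as ℕₚ
import Data.Nat.Tactic.RingSolver as ℕR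
open import Data.Integer using (ℤ; 0ℤ; 1ℤ; -1ℤ; ∣_∣; _⊓_; _⊔_)
import Data.Integer as ℤ
import Data.Integer.Properties as ℤₚ
import Data.Integer.Tactic.RingSolver as ℤR
open import Data.List using (List; []; _∷_; length)
open import Data.List.Membership.Propositional using (_∈_; find)
import Data.List.Membership.DecPropositional as DecMembership
open import Data.List.Relation.Binary.Subset.Propositional using (_⊆_)
open import Data.List.Relation.Unary.All using (All; []; _∷_)
open import Data.List.Relation.Unary.Any using (here; there)
import Data.List.Relation.Unary.Any as Any
open import Data.Product using (_,_; ∃; proj₁; proj₂)
open import Data.Product.Properties using (≡-dec)
open import Data.Sum using (inj₁; inj₂)
open import Function using (_∘_; id)
open import Relation.Binary.PropositionalEquality
  using (_≡_; refl; sym; trans; cong; cong₂; subst; subst₂; module ≡-Reasoning)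
open import Relation.Nullary using (yes; no)

-- Distances on the line and the L₁-distance in the plane

ρ : ℤ → ℤ → ℕ
ρ u v = ∣ u ℤ.- v ∣

ρ-refl : ∀ u → ρ u u ≡ 0
ρ-refl u = cong ∣_∣ (ℤₚ.+-inverseʳ u)

ρ-sym : ∀ u v → ρ u v ≡ ρ v u
ρ-sym = ℤₚ.∣i-j∣≡∣j-i∣

telescope : ∀ u v w → (u ℤ.- v) ℤ.+ (v ℤ.- w) ≡ u ℤ.- w
telescope = ℤR.solve-∀

ρ-triangle : ∀ u v w → ρ u w ≤ ρ u v + ρ v w
ρ-triangle u v w = subst (λ i → ∣ i ∣ ≤ ρ u v + ρ v w) (telescope u v w)
  (ℤₚ.∣i+j∣≤∣i∣+∣j∣ (u ℤ.- v) (v ℤ.- w))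

+ρ : ∀ {u v} → u ℤ.≤ v → + ρ v u ≡ v ℤ.- u
+ρ u≤v = ℤₚ.0≤i⇒+∣i∣≡i (ℤₚ.i≤j⇒0≤j-i u≤v)

d : Point → Point → ℕ
d p q = ρ (xc p) (xc q) + ρ (yc p) (yc q)

d-refl : ∀ p → d p p ≡ 0
d-refl (x , y) = cong₂ _+_ (ρ-refl x) (ρ-refl y)

d-sym : ∀ p q → d p q ≡ d q p
d-sym (x , y) (x' , y') = cong₂ _+_ (ρ-sym x x') (ρ-sym y y')

+-interchange : ∀ a b c e → (a + b) + (c + e) ≡ (a + c) + (b + e)
+-interchange = ℕR.solve-∀

d-triangle : ∀ p q r → d p r ≤ d p q + d q r
d-triangle (x , y) (x' , y') (x″ , y″) = subst (ρ x x″ + ρ y y″ ≤_)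
  (+-interchange (ρ x x') (ρ x' x″) (ρ y y') (ρ y' y″))
  (ℕₚ.+-mono-≤ (ρ-triangle x x' x″) (ρ-triangle y y' y″))

d-adj : ∀ {u v} → Adj v u → ∀ p → d p v ≤ suc (d p u)
d-adj {u} {v} v~u p = begin
  d p v          ≤⟨ d-triangle p u v ⟩
  d p u + d u v  ≡⟨ cong (λ k → d p u + k) (trans (d-sym u v) v~u) ⟩
  d p u + 1      ≡⟨ ℕₚ.+-comm (d p u) 1 ⟩
  suc (d p u)    ∎
  where open ℕₚ.≤-Reasoning

-- Lower bounds for trees

-- Induction on the growth of the tree: replacing the new leaf by its neighbour changes a distance
-- by at most one, and the leaf adds one vertex. The inequality is strict because `length vs` counts
-- vertices, one more than the edges.
path≤ : ∀ {vs} → GridTree vs → ∀ {a b} → a ∈ vs → b ∈ vs → d a b < length vs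
path≤ (single v) (here refl) (here refl) = s≤s (ℕₚ.≤-reflexive (d-refl v))
path≤ (grow v T _ _) (here refl) (here refl) = s≤s (ℕₚ.≤-trans (ℕₚ.≤-reflexive (d-refl v)) z≤n)
path≤ (grow v T _ n) {a} (there a∈) (here refl) with find n
... | u , u∈ , v~u = s≤s (ℕₚ.≤-trans (d-adj v~u a) (path≤ T a∈ u∈))
path≤ (grow v T _ n) {b = b} (here refl) (there b∈) with find n
... | u , u∈ , v~u = s≤s (ℕₚ.≤-trans (ℕₚ.≤-reflexive (d-sym v b))
  (ℕₚ.≤-trans (d-adj v~u b) (path≤ T b∈ u∈)))
path≤ (grow v T _ _) (there a∈) (there b∈) = ℕₚ.m<n⇒m<1+n (path≤ T a∈ b∈)

-- Here `n` is a vertex count, so `< n` bounds the three legs by the number of edges. The hub may be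
-- any lattice point.
Tripod : ℕ → Point → Point → Point → Set
Tripod n a b c = ∃ λ p → d p a + (d p b + d p c) < n

tripod-rotate : ∀ {n a b c} → Tripod n a b c → Tripod n c a b
tripod-rotate {n} {a} {b} {c} (p , lt) = p , subst (_< n) (rotate (d p a) (d p b) (d p c)) lt
  where
  rotate : ∀ a b c → a + (b + c) ≡ c + (a + b)
  rotate = ℕR.solve-∀

tripod-move : ∀ {n u v b c} → Adj v u → Tripod n u b c → Tripod (suc n) v b c
tripod-move v~u (p , lt) = p , s≤s (ℕₚ.≤-trans (ℕₚ.+-monoˡ-≤ _ (d-adj v~u p)) lt)

tripod-degenerate : ∀ {n a c} → d a c < n → Tripod n a a c
tripod-degenerate {n} {a} {c} lt =
  a , subst (_< n) (sym (cong₂ (λ i j → i + (j + d a c)) (d-refl a) (d-refl a))) lt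

-- If two of the points sit at the newest vertex, that vertex serves as the hub and `path≤`
-- suffices. If exactly one does, it is moved to the neighbour of the leaf; rotations bring it to
-- the front.
tripod : ∀ {vs} → GridTree vs → ∀ {a b c} → a ∈ vs → b ∈ vs → c ∈ vs → Tripod (length vs) a b c
tripod T (here refl) (here refl) c∈ = tripod-degenerate (path≤ T (here refl) c∈)
tripod T (here refl) b∈ (here refl) =
  tripod-rotate (tripod-rotate (tripod-degenerate (path≤ T (here refl) b∈)))
tripod T a∈ (here refl) (here refl) = tripod-rotate (tripod-degenerate (path≤ T (here refl) a∈))
tripod (grow v T _ n) (here refl) (there b∈) (there c∈) with find n
... | u , u∈ , v~u = tripod-move v~u (tripod T u∈ b∈ c∈)
tripod (grow v T _ n) (there a∈) (here refl) (there c∈) with find n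
... | u , u∈ , v~u = tripod-rotate (tripod-move v~u (tripod T u∈ c∈ a∈))
tripod (grow v T _ n) (there a∈) (there b∈) (here refl) with find n
... | u , u∈ , v~u = tripod-rotate (tripod-rotate (tripod-move v~u (tripod T u∈ a∈ b∈)))
tripod (grow v T _ _) (there a∈) (there b∈) (there c∈) with tripod T a∈ b∈ c∈
... | p , lt = p , ℕₚ.m<n⇒m<1+n lt

-- The shape of a tree with four ends and branching points `q` and `p`: the pair `a`, `b` hangs off
-- `q`, the pair `c`, `e` off `p`.
Quartet : ℕ → Point → Point → Point → Point → Set
Quartet n a b c e = ∃ λ q → ∃ λ p → (d q a + d q b) + d q p + (d p c + d p e) < n

quartet-swap : ∀ {n a b c e} → Quartet n a b c e → Quartet n b a c e
quartet-swap {n} {a} {b} {c} {e} (q , p , lt) =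
  q , p , subst (λ k → k + d q p + (d p c + d p e) < n) (ℕₚ.+-comm (d q a) (d q b)) lt

quartet-flip : ∀ {n a b c e} → Quartet n a b c e → Quartet n c e a b
quartet-flip {n} {a} {b} {c} {e} (q , p , lt) = p , q , subst (_< n) eq lt
  where
  reverse : ∀ i j k → i + j + k ≡ k + j + i
  reverse = ℕR.solve-∀
  eq : (d q a + d q b) + d q p + (d p c + d p e) ≡ (d p c + d p e) + d p q + (d q a + d q b)
  eq = trans (reverse (d q a + d q b) (d q p) (d p c + d p e))
             (cong (λ k → (d p c + d p e) + k + (d q a + d q b)) (d-sym q p))

quartet-move : ∀ {n u v b c e} → Adj v u → Quartet n u b c e → Quartet (suc n) v b c e
quartet-move v~u (q , p , lt) = q , p , s≤s (ℕₚ.≤-trans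
  (ℕₚ.+-monoˡ-≤ _ (ℕₚ.+-monoˡ-≤ _ (ℕₚ.+-monoˡ-≤ _ (d-adj v~u q)))) lt)

quartet-degenerate : ∀ {n a c e} → Tripod n a c e → Quartet n a a c e
quartet-degenerate {n} {a} {c} {e} (p , lt) = a , p , subst (_< n) eq lt
  where
  eq : d p a + (d p c + d p e) ≡ (d a a + d a a) + d a p + (d p c + d p e)
  eq = cong (_+ (d p c + d p e))
    (trans (d-sym p a) (sym (cong₂ (λ i j → i + j + d a p) (d-refl a) (d-refl a))))

-- The three alternatives are the three ways to split four points into two pairs. The partner of `z`
-- later determines which octagon contains `z`.
AnyQuartet : ℕ → Point → Point → Point → Point → Set
AnyQuartet n z a b c = Quartet n z a b c ⊎ Quartet n z b a c ⊎ Quartet n z c a b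

-- Exchanging `z` and `a` preserves the splitting that pairs them and interchanges the other two
-- alternatives up to the order of the pairs.
anyQuartet-swap₁ : ∀ {n z a b c} → AnyQuartet n z a b c → AnyQuartet n a z b c
anyQuartet-swap₁ (inj₁ Q)        = inj₁ (quartet-swap Q)
anyQuartet-swap₁ (inj₂ (inj₁ Q)) = inj₂ (inj₂ (quartet-flip Q))
anyQuartet-swap₁ (inj₂ (inj₂ Q)) = inj₂ (inj₁ (quartet-flip Q))

quartet-swap₂ : ∀ {n a b c e} → Quartet n a b c e → Quartet n a b e c
quartet-swap₂ = quartet-flip ∘ quartet-swap ∘ quartet-flip

anyQuartet-swap₂ : ∀ {n z a b c} → AnyQuartet n z a b c → AnyQuartet n z b a c
anyQuartet-swap₂ (inj₁ Q)        = inj₂ (inj₁ Q)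
anyQuartet-swap₂ (inj₂ (inj₁ Q)) = inj₁ Q
anyQuartet-swap₂ (inj₂ (inj₂ Q)) = inj₂ (inj₂ (quartet-swap₂ Q))

anyQuartet-swap₃ : ∀ {n z a b c} → AnyQuartet n z a b c → AnyQuartet n z a c b
anyQuartet-swap₃ (inj₁ Q)        = inj₁ (quartet-swap₂ Q)
anyQuartet-swap₃ (inj₂ (inj₁ Q)) = inj₂ (inj₂ Q)
anyQuartet-swap₃ (inj₂ (inj₂ Q)) = inj₂ (inj₁ Q)

anyQuartet-move : ∀ {n u v a b c} → Adj v u → AnyQuartet n u a b c → AnyQuartet (suc n) v a b c
anyQuartet-move v~u (inj₁ Q)        = inj₁ (quartet-move v~u Q)
anyQuartet-move v~u (inj₂ (inj₁ Q)) = inj₂ (inj₁ (quartet-move v~u Q))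
anyQuartet-move v~u (inj₂ (inj₂ Q)) = inj₂ (inj₂ (quartet-move v~u Q))

quartet-weaken : ∀ {n a b c e} → Quartet n a b c e → Quartet (suc n) a b c e
quartet-weaken (q , p , lt) = q , p , ℕₚ.m<n⇒m<1+n lt

anyQuartet-weaken : ∀ {n z a b c} → AnyQuartet n z a b c → AnyQuartet (suc n) z a b c
anyQuartet-weaken (inj₁ Q)        = inj₁ (quartet-weaken Q)
anyQuartet-weaken (inj₂ (inj₁ Q)) = inj₂ (inj₁ (quartet-weaken Q))
anyQuartet-weaken (inj₂ (inj₂ Q)) = inj₂ (inj₂ (quartet-weaken Q))

-- If the new leaf carries two of the four points, the tripod bound suffices;
-- if it carries one, that point is moved to the neighbour of the leaf.
anyQuartet : ∀ {vs} → GridTree vs → ∀ {z a b c} → z ∈ vs → a ∈ vs → b ∈ vs → c ∈ vs →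
             AnyQuartet (length vs) z a b c
anyQuartet T (here refl) (here refl) b∈ c∈ =
  inj₁ (quartet-degenerate (tripod T (here refl) b∈ c∈))
anyQuartet T (here refl) a∈ (here refl) c∈ =
  inj₂ (inj₁ (quartet-degenerate (tripod T (here refl) a∈ c∈)))
anyQuartet T (here refl) a∈ b∈ (here refl) =
  inj₂ (inj₂ (quartet-degenerate (tripod T (here refl) a∈ b∈)))
anyQuartet T z∈ (here refl) (here refl) c∈ =
  inj₂ (inj₂ (quartet-flip (quartet-degenerate (tripod T (here refl) z∈ c∈))))
anyQuartet T z∈ (here refl) b∈ (here refl) =
  inj₂ (inj₁ (quartet-flip (quartet-degenerate (tripod T (here refl) z∈ b∈))))
anyQuartet T z∈ a∈ (here refl) (here refl) =
  inj₁ (quartet-flip (quartet-degenerate (tripod T (here refl) z∈ a∈)))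
anyQuartet (grow v T _ n) (here refl) (there a∈) (there b∈) (there c∈) with find n
... | u , u∈ , v~u = anyQuartet-move v~u (anyQuartet T u∈ a∈ b∈ c∈)
anyQuartet (grow v T _ n) (there z∈) (here refl) (there b∈) (there c∈) with find n
... | u , u∈ , v~u = anyQuartet-swap₁ (anyQuartet-move v~u (anyQuartet T u∈ z∈ b∈ c∈))
anyQuartet (grow v T _ n) (there z∈) (there a∈) (here refl) (there c∈) with find n
... | u , u∈ , v~u = anyQuartet-swap₂ (anyQuartet-swap₁
  (anyQuartet-move v~u (anyQuartet T u∈ z∈ a∈ c∈)))
anyQuartet (grow v T _ n) (there z∈) (there a∈) (there b∈) (here refl) with find n
... | u , u∈ , v~u = anyQuartet-swap₃ (anyQuartet-swap₂ (anyQuartet-swap₁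
  (anyQuartet-move v~u (anyQuartet T u∈ z∈ a∈ b∈))))
anyQuartet (grow v T _ _) (there z∈) (there a∈) (there b∈) (there c∈) =
  anyQuartet-weaken (anyQuartet T z∈ a∈ b∈ c∈)

-- Building trees

open DecMembership (≡-dec ℤₚ._≟_ ℤₚ._≟_) using (_∈?_)

Extension : List Point → Point → ℕ → Set
Extension vs w k = ∃ λ vs' → GridTree vs' × vs ⊆ vs' × w ∈ vs' × length vs' ≤ length vs + k

-- A vertex that the tree already contains is reused, since a leaf must be new; this is why
-- `Extension` only bounds the number of added vertices from above.
extend-adj : ∀ {vs w w' k} → Adj w' w → Extension vs w k → Extension vs w' (suc k)
extend-adj {vs} {w} {w'} {k} w'~w (vs' , T , vs⊆ , w∈ , len) with w' ∈? vs'
... | yes w'∈ = vs' , T , vs⊆ , w'∈ , ℕₚ.≤-trans len (ℕₚ.+-monoʳ-≤ (length vs) (ℕₚ.n≤1+n k))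
... | no w'∉ = w' ∷ vs' , grow w' T w'∉ (Any.map (λ { refl → w'~w }) w∈) , there ∘ vs⊆ , here refl ,
  subst (suc (length vs') ≤_) (sym (ℕₚ.+-suc (length vs) k)) (s≤s len)

extend-line : ∀ {vs x y} → GridTree vs → (x , y) ∈ vs → ∀ σ τ → ∣ σ ∣ + ∣ τ ∣ ≡ 1 → ∀ n →
              Extension vs (x ℤ.+ + n ℤ.* σ , y ℤ.+ + n ℤ.* τ) n
extend-line {vs} {x} {y} T v∈ σ τ unit zero =
  vs , T , id , subst (_∈ vs) (cong₂ _,_ (sym (stay x σ)) (sym (stay y τ))) v∈ ,
  ℕₚ.≤-reflexive (sym (ℕₚ.+-identityʳ _))
  where
  stay : ∀ x σ → x ℤ.+ 0ℤ ℤ.* σ ≡ x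
  stay = ℤR.solve-∀
extend-line {vs} {x} {y} T v∈ σ τ unit (suc n) =
  extend-adj (trans (cong₂ (λ i j → ∣ i ∣ + ∣ j ∣) (advance x (+ n) σ) (advance y (+ n) τ)) unit)
             (extend-line T v∈ σ τ unit n)
  where
  advance : ∀ x n σ → (x ℤ.+ (1ℤ ℤ.+ n) ℤ.* σ) ℤ.- (x ℤ.+ n ℤ.* σ) ≡ σ
  advance = ℤR.solve-∀

-- Equal coordinates also receive a unit direction, which is then followed for zero steps.
direction : ∀ x x' → ∃ λ σ → ∣ σ ∣ ≡ 1 × x ℤ.+ + ρ x x' ℤ.* σ ≡ x'
direction x x' with ℤₚ.≤-total x x'
... | inj₁ x≤x' = 1ℤ , refl , trans
    (cong (λ i → x ℤ.+ i ℤ.* 1ℤ) (trans (cong +_ (ρ-sym x x')) (+ρ x≤x'))) (right x x')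
  where
  right : ∀ x x' → x ℤ.+ (x' ℤ.- x) ℤ.* 1ℤ ≡ x'
  right = ℤR.solve-∀
... | inj₂ x'≤x = -1ℤ , refl , trans (cong (λ i → x ℤ.+ i ℤ.* -1ℤ) (+ρ x'≤x)) (left x x')
  where
  left : ∀ x x' → x ℤ.+ (x ℤ.- x') ℤ.* -1ℤ ≡ x'
  left = ℤR.solve-∀

extend-trans : ∀ {vs u w k l} (E : Extension vs u k) → Extension (proj₁ E) w l →
               Extension vs w (k + l)
extend-trans {vs} {k = k} {l} (vs' , T , vs⊆ , u∈ , len) (vs″ , T' , vs'⊆ , w∈ , len') =
  vs″ , T' , vs'⊆ ∘ vs⊆ , w∈ , ℕₚ.≤-trans len'
    (subst (length vs' + l ≤_) (ℕₚ.+-assoc (length vs) k l) (ℕₚ.+-monoˡ-≤ l len))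

-- An L-shaped path, first horizontal and then vertical, has exactly the L₁-distance as its length.
extend : ∀ {vs u} → GridTree vs → u ∈ vs → ∀ w → Extension vs w (d u w)
extend {vs} {x , y} T u∈ (x' , y') with direction x x' | direction y y'
... | σ , ∣σ∣≡1 , x→x' | τ , ∣τ∣≡1 , y→y' = extend-trans horizontal vertical
  where
  fixed : ∀ y (n : ℤ) → y ℤ.+ n ℤ.* 0ℤ ≡ y
  fixed = ℤR.solve-∀
  horizontal : Extension vs (x' , y) (ρ x x')
  horizontal = subst (λ v → Extension vs v (ρ x x')) (cong₂ _,_ x→x' (fixed y (+ ρ x x')))
    (extend-line T u∈ σ 0ℤ (cong (_+ 0) ∣σ∣≡1) (ρ x x'))
  vertical : Extension (proj₁ horizontal) (x' , y') (ρ y y')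
  vertical = let _ , T' , _ , v∈ , _ = horizontal in
    subst (λ v → Extension (proj₁ horizontal) v (ρ y y')) (cong₂ _,_ (fixed x' (+ ρ y y')) y→y')
      (extend-line T' v∈ 0ℤ τ ∣τ∣≡1 (ρ y y'))

-- The path from `m` to `a` is routed through `s`, where the branch to `z` leaves; `b` and `c` are
-- joined directly to `m`.
hubTree : ∀ m s a b c z →
          TreeWithin (d m s + d s a + d m b + d m c + d s z) (a ∷ b ∷ c ∷ z ∷ [])
hubTree m s a b c z =
  let _ , T₁ , m⊆₁ , s∈ , l₁ = extend (single m) (here refl) s
      _ , T₂ , ⊆₂ , a∈ , l₂ = extend T₁ s∈ a
      _ , T₃ , ⊆₃ , b∈ , l₃ = extend T₂ (⊆₂ (m⊆₁ (here refl))) b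
      _ , T₄ , ⊆₄ , c∈ , l₄ = extend T₃ (⊆₃ (⊆₂ (m⊆₁ (here refl)))) c
      _ , T₅ , ⊆₅ , z∈ , l₅ = extend T₄ (⊆₄ (⊆₃ (⊆₂ s∈))) z
  in _ , T₅ ,
     chain l₅ (chain l₄ (chain l₃ (chain l₂ l₁))) ,
     ⊆₅ (⊆₄ (⊆₃ a∈)) ∷ ⊆₅ (⊆₄ b∈) ∷ ⊆₅ c∈ ∷ z∈ ∷ []
  where
  chain : ∀ {i j k l} → i ≤ j + k → j ≤ l → i ≤ l + k
  chain {k = k} i≤ j≤ = ℕₚ.≤-trans i≤ (ℕₚ.+-monoˡ-≤ k j≤)

treeWithin-map : ∀ {k as bs} → (∀ {vs} → All (_∈ vs) as → All (_∈ vs) bs) →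
                 TreeWithin k as → TreeWithin k bs
treeWithin-map f (vs , T , len , ∈s) = vs , T , len , f ∈s

treeWithin-mono : ∀ {k l as} → k ≤ l → TreeWithin k as → TreeWithin l as
treeWithin-mono k≤l (vs , T , len , ∈s) = vs , T , ℕₚ.≤-trans len (s≤s k≤l) , ∈s

-- One coordinate

Between : ℤ → ℤ → ℤ → Set
Between u v w = ρ u v + ρ v w ≡ ρ u w

between-sym : ∀ {u v w} → Between u v w → Between w v u
between-sym {u} {v} {w} uvw = begin
  ρ w v + ρ v u  ≡⟨ cong₂ _+_ (ρ-sym w v) (ρ-sym v u) ⟩
  ρ v w + ρ u v  ≡⟨ ℕₚ.+-comm (ρ v w) (ρ u v) ⟩
  ρ u v + ρ v w  ≡⟨ uvw ⟩
  ρ u w          ≡⟨ ρ-sym u w ⟩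
  ρ w u          ∎
  where open ≡-Reasoning

between-≥ : ∀ {u v w} → v ℤ.≤ u → w ℤ.≤ v → Between u v w
between-≥ {u} {v} {w} v≤u w≤v = ℤₚ.+-injective (begin
  + ρ u v ℤ.+ + ρ v w          ≡⟨ cong₂ ℤ._+_ (+ρ v≤u) (+ρ w≤v) ⟩
  (u ℤ.- v) ℤ.+ (v ℤ.- w)      ≡⟨ telescope u v w ⟩
  u ℤ.- w                      ≡⟨ +ρ (ℤₚ.≤-trans w≤v v≤u) ⟨
  + ρ u w                      ∎)
  where
  open ≡-Reasoning

between-≤ : ∀ {u v w} → u ℤ.≤ v → v ℤ.≤ w → Between u v w
between-≤ {u} {v} {w} u≤v v≤w = between-sym {w} {v} {u} (between-≥ v≤w u≤v)

-- For `α ≤ β` the index is the point of the interval nearest to `x`. Recording the case lets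
-- pattern matching fix both that point and the side on which `x` lies.
data Clamp (α β x : ℤ) : ℤ → Set where
  below  : x ℤ.≤ α → Clamp α β x α
  inside : α ℤ.≤ x → x ℤ.≤ β → Clamp α β x x
  above  : β ℤ.≤ x → Clamp α β x β

clamp : ∀ α β x → ∃ (Clamp α β x)
clamp α β x with ℤₚ.≤-total x α | ℤₚ.≤-total x β
... | inj₁ x≤α | _        = α , below x≤α
... | inj₂ _   | inj₂ β≤x = β , above β≤x
... | inj₂ α≤x | inj₁ x≤β = x , inside α≤x x≤β

-- One coordinate of the length bounded in `Quartet`, with `x` the coordinate of `z`.
bridge : (q p x a b c : ℤ) → ℕ
bridge q p x a b c = (ρ q x + ρ q a) + ρ q p + (ρ p b + ρ p c)

ρ-hub : ∀ q u v → ρ u v ≤ ρ q u + ρ q v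
ρ-hub q u v = subst (λ i → ρ u v ≤ i + ρ q v) (ρ-sym u q) (ρ-triangle u q v)

bridge-swap : ∀ q p x a b c → bridge q p a x b c ≡ bridge q p x a b c
bridge-swap q p x a b c = cong (λ i → i + ρ q p + (ρ p b + ρ p c)) (ℕₚ.+-comm (ρ q a) (ρ q x))

-- Only the path from `a` through `q` and `p` to `c` is kept.
across≤bridge : ∀ q p x a b c → ρ a c ≤ bridge q p x a b c
across≤bridge q p x a b c = begin
  ρ a c                                        ≤⟨ ρ-hub q a c ⟩
  ρ q a + ρ q c                                ≤⟨ ℕₚ.+-monoʳ-≤ (ρ q a) (ρ-triangle q p c) ⟩
  ρ q a + (ρ q p + ρ p c)                      ≤⟨ ℕₚ.m≤m+n _ (ρ q x + ρ p b) ⟩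
  ρ q a + (ρ q p + ρ p c) + (ρ q x + ρ p b)    ≡⟨ rearrange (ρ q a) (ρ q p) (ρ p c) (ρ q x) (ρ p b) ⟩
  bridge q p x a b c                           ∎
  where
  open ℕₚ.≤-Reasoning
  rearrange : ∀ i j k l n → i + (j + k) + (l + n) ≡ (l + i) + j + (n + k)
  rearrange = ℕR.solve-∀

-- The middle path is dropped; the two pairs of end paths each satisfy a triangle inequality.
ends≤bridge : ∀ q p x a b c → ρ x a + ρ b c ≤ bridge q p x a b c
ends≤bridge q p x a b c = ℕₚ.+-mono-≤
  (ℕₚ.≤-trans (ρ-hub q x a) (ℕₚ.m≤m+n _ (ρ q p))) (ρ-hub p b c)

star : ℤ → ℤ → ℤ → ℤ → ℕ
star m a b c = ρ m a + (ρ m b + ρ m c)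

-- m is the median of a, b, c, and [α, β] is the interval spanned by a and m.
record Median (a b c α β : ℤ) : Set where
  field
    m           : ℤ
    α≤β         : α ℤ.≤ β
    between     : ∀ {x s} → Clamp α β x s → Between m s a
    star-min    : ∀ p → star m a b c ≤ star p a b c
    bridge-min  : ∀ {x s} → Clamp α β x s → ∀ q p → star m a b c + ρ s x ≤ bridge q p x a b c

median-swap : ∀ {a b c α β} → Median a b c α β → Median a c b α β
median-swap {a} {b} {c} M = record
  { m          = m
  ; α≤β        = α≤β
  ; between    = between
  ; star-min   = λ p → subst₂ _≤_ (star-comm m) (star-comm p) (star-min p)
  ; bridge-min = λ {x} {s} cl q p → subst₂ _≤_ (cong (_+ ρ s x) (star-comm m))
      (cong (λ i → ρ q x + ρ q a + ρ q p + i) (ℕₚ.+-comm (ρ p b) (ρ p c))) (bridge-min cl q p)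
  }
  where
  open Median M
  star-comm : ∀ p → star p a b c ≡ star p a c b
  star-comm p = cong (λ i → ρ p a + i) (ℕₚ.+-comm (ρ p b) (ρ p c))

-- Here `a` is itself the median and the interval is a single point, so the clamped point is `a` and
-- the bridge bound is exactly `ends≤bridge`.
median-middle : ∀ {a b c} → b ℤ.≤ a → a ℤ.≤ c → Median a b c a a
median-middle {a} {b} {c} b≤a a≤c = record
  { m          = a
  ; α≤β        = ℤₚ.≤-refl
  ; between    = λ cl → subst (λ s → Between a s a) (sym (clamp≡ cl)) (between-≤ {a} ℤₚ.≤-refl ℤₚ.≤-refl)
  ; star-min   = λ p → ℕₚ.≤-trans (ℕₚ.≤-reflexive star≡)
      (ℕₚ.≤-trans (ρ-hub p b c) (ℕₚ.m≤n+m _ (ρ p a)))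
  ; bridge-min = λ {x} {s} cl q p → begin
      star a a b c + ρ s x  ≡⟨ cong₂ (λ i s → i + ρ s x) star≡ (clamp≡ cl) ⟩
      ρ b c + ρ a x         ≡⟨ ℕₚ.+-comm (ρ b c) (ρ a x) ⟩
      ρ a x + ρ b c         ≡⟨ cong (_+ ρ b c) (ρ-sym a x) ⟩
      ρ x a + ρ b c         ≤⟨ ends≤bridge q p x a b c ⟩
      bridge q p x a b c    ∎
  }
  where
  open ℕₚ.≤-Reasoning
  clamp≡ : ∀ {x s} → Clamp a a x s → s ≡ a
  clamp≡ (below _)        = refl
  clamp≡ (inside a≤x x≤a) = ℤₚ.≤-antisym x≤a a≤x
  clamp≡ (above _)        = refl
  star≡ : star a a b c ≡ ρ b c
  star≡ = trans (cong₂ (λ i j → i + (j + ρ a c)) (ρ-refl a) (ρ-sym a b)) (between-≤ b≤a a≤c)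

-- Positions are stated through betweenness instead of order, so that one argument covers `a` as the
-- least and as the greatest of the three.
data Position (a b c x : ℤ) : ℤ → Set where
  beyond-a : Between x a c → Position a b c x a
  at       : Position a b c x x
  beyond-b : Between a b x → Position a b c x b

-- With `b` between `a` and `c`, the star at `b` has length `ρ a c`. What remains of the bridge
-- bound depends on whether `x` lies beyond `a`, at its clamped point, or beyond `b`.
median-end : ∀ {a b c α β} → α ℤ.≤ β → Between a b c →
             (∀ {x s} → Clamp α β x s → Between b s a × Position a b c x s) → Median a b c α β
median-end {a} {b} {c} α≤β abc locate = record
  { m          = b
  ; α≤β        = α≤β
  ; between    = proj₁ ∘ locate
  ; star-min   = λ p → ℕₚ.≤-trans (ℕₚ.≤-reflexive star≡)
      (ℕₚ.≤-trans (ρ-hub p a c) (ℕₚ.+-monoʳ-≤ (ρ p a) (ℕₚ.m≤n+m _ (ρ p b))))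
  ; bridge-min = λ cl q p → bound q p (proj₂ (locate cl))
  }
  where
  open ℕₚ.≤-Reasoning
  star≡ : star b a b c ≡ ρ a c
  star≡ = trans (cong₂ (λ i j → i + (j + ρ b c)) (ρ-sym b a) (ρ-refl b)) abc
  bound : ∀ {x s} q p → Position a b c x s → star b a b c + ρ s x ≤ bridge q p x a b c
  bound {x} q p (beyond-a xac) = begin
    star b a b c + ρ a x  ≡⟨ cong₂ _+_ star≡ (ρ-sym a x) ⟩
    ρ a c + ρ x a         ≡⟨ ℕₚ.+-comm (ρ a c) (ρ x a) ⟩
    ρ x a + ρ a c         ≡⟨ xac ⟩
    -- The roles of `x` and `a` are exchanged: the path crossing the bridge now starts at `x`, the
    -- outermost point.
    ρ x c                 ≤⟨ across≤bridge q p a x b c ⟩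
    bridge q p a x b c    ≡⟨ bridge-swap q p x a b c ⟩
    bridge q p x a b c    ∎
  bound {x} q p at = begin
    star b a b c + ρ x x  ≡⟨ cong₂ _+_ star≡ (ρ-refl x) ⟩
    ρ a c + 0             ≡⟨ ℕₚ.+-identityʳ (ρ a c) ⟩
    ρ a c                 ≤⟨ across≤bridge q p x a b c ⟩
    bridge q p x a b c    ∎
  bound {x} q p (beyond-b abx) = begin
    star b a b c + ρ b x       ≡⟨ cong (_+ ρ b x) star≡ ⟩
    ρ a c + ρ b x              ≡⟨ cong (_+ ρ b x) abc ⟨
    -- Regrouping turns the detour from `b` to `x` into a path from `a` to `x`, leaving the two end
    -- paths of `ends≤bridge`.
    (ρ a b + ρ b c) + ρ b x    ≡⟨ rearrange (ρ a b) (ρ b c) (ρ b x) ⟩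
    (ρ a b + ρ b x) + ρ b c    ≡⟨ cong (_+ ρ b c) (trans abx (ρ-sym a x)) ⟩
    ρ x a + ρ b c              ≤⟨ ends≤bridge q p x a b c ⟩
    bridge q p x a b c         ∎
    where
    rearrange : ∀ i j k → (i + j) + k ≡ (i + k) + j
    rearrange = ℕR.solve-∀

median-least : ∀ {a b c} → a ℤ.≤ b → b ℤ.≤ c → Median a b c a b
median-least {a} {b} {c} a≤b b≤c = median-end a≤b (between-≤ a≤b b≤c) locate
  where
  locate : ∀ {x s} → Clamp a b x s → Between b s a × Position a b c x s
  locate (below x≤a)      = between-≥ a≤b ℤₚ.≤-refl ,
    beyond-a (between-≤ x≤a (ℤₚ.≤-trans a≤b b≤c))
  locate (inside a≤x x≤b) = between-≥ x≤b a≤x , at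
  locate (above b≤x)      = between-≥ ℤₚ.≤-refl a≤b , beyond-b (between-≤ a≤b b≤x)

median-greatest : ∀ {a b c} → c ℤ.≤ b → b ℤ.≤ a → Median a b c b a
median-greatest {a} {b} {c} c≤b b≤a = median-end b≤a (between-≥ b≤a c≤b) locate
  where
  locate : ∀ {x s} → Clamp b a x s → Between b s a × Position a b c x s
  locate (below x≤b)      = between-≤ ℤₚ.≤-refl b≤a , beyond-b (between-≥ b≤a x≤b)
  locate (inside b≤x x≤a) = between-≤ b≤x x≤a , at
  locate (above a≤x)      = between-≤ b≤a ℤₚ.≤-refl ,
    beyond-a (between-≥ a≤x (ℤₚ.≤-trans c≤b b≤a))

-- The max-min formulas evaluate to the interval between `a` and the median in each of the three
-- positions of `a` relative to `b` and `c`.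
median-≤ : ∀ a {b c} → b ℤ.≤ c → Median a b c ((a ⊓ b) ⊔ (a ⊓ c)) ((a ⊔ b) ⊓ (a ⊔ c))
median-≤ a {b} {c} b≤c with ℤₚ.≤-total a b | ℤₚ.≤-total a c
... | inj₁ a≤b | _
  rewrite ℤₚ.i≤j⇒i⊓j≡i a≤b | ℤₚ.i≤j⇒i⊓j≡i (ℤₚ.≤-trans a≤b b≤c) | ℤₚ.⊔-idem a
        | ℤₚ.i≤j⇒i⊔j≡j a≤b | ℤₚ.i≤j⇒i⊔j≡j (ℤₚ.≤-trans a≤b b≤c) | ℤₚ.i≤j⇒i⊓j≡i b≤c
  = median-least a≤b b≤c
... | inj₂ b≤a | inj₁ a≤c
  rewrite ℤₚ.i≥j⇒i⊓j≡j b≤a | ℤₚ.i≤j⇒i⊓j≡i a≤c | ℤₚ.i≤j⇒i⊔j≡j b≤a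
        | ℤₚ.i≥j⇒i⊔j≡i b≤a | ℤₚ.i≤j⇒i⊔j≡j a≤c | ℤₚ.i≤j⇒i⊓j≡i a≤c
  = median-middle b≤a a≤c
... | inj₂ b≤a | inj₂ c≤a
  rewrite ℤₚ.i≥j⇒i⊓j≡j b≤a | ℤₚ.i≥j⇒i⊓j≡j c≤a | ℤₚ.i≤j⇒i⊔j≡j b≤c
        | ℤₚ.i≥j⇒i⊔j≡i b≤a | ℤₚ.i≥j⇒i⊔j≡i c≤a | ℤₚ.⊓-idem a
  = median-swap (median-greatest b≤c c≤a)

median : ∀ a b c → Median a b c ((a ⊓ b) ⊔ (a ⊓ c)) ((a ⊔ b) ⊓ (a ⊔ c))
median a b c with ℤₚ.≤-total b c
... | inj₁ b≤c = median-≤ a b≤c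
... | inj₂ c≤b = subst₂ (Median a b c) (ℤₚ.⊔-comm (a ⊓ c) (a ⊓ b)) (ℤₚ.⊓-comm (a ⊔ c) (a ⊔ b))
  (median-swap (median-≤ a c≤b))

-- Octagons as L₁-balls around rectangles

-- Reduces a linear inequality to a sum of known ones plus a ring identity between the differences
-- of the two sides.
≤-transfer : ∀ {i j k l} → i ℤ.≤ j → j ℤ.- i ≡ l ℤ.- k → k ℤ.≤ l
≤-transfer i≤j eq = ℤₚ.0≤i-j⇒j≤i (subst (0ℤ ℤ.≤_) eq (ℤₚ.i≤j⇒0≤j-i i≤j))

x+[y-x]≡y : ∀ x y → x ℤ.+ (y ℤ.- x) ≡ y
x+[y-x]≡y = ℤR.solve-∀

α≤x+ρ : ∀ {α β x s} → α ℤ.≤ β → Clamp α β x s → α ℤ.≤ x ℤ.+ + ρ s x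
α≤x+ρ {α} {x = x} α≤β (below x≤α) =
  ℤₚ.≤-reflexive (sym (trans (cong (λ e → x ℤ.+ e) (+ρ x≤α)) (x+[y-x]≡y x α)))
α≤x+ρ α≤β (inside α≤x _) = ℤₚ.≤-trans α≤x (ℤₚ.i≤i+j _ _)
α≤x+ρ α≤β (above β≤x)    = ℤₚ.≤-trans (ℤₚ.≤-trans α≤β β≤x) (ℤₚ.i≤i+j _ _)

x≤β+ρ : ∀ {α β x s} → α ℤ.≤ β → Clamp α β x s → x ℤ.≤ β ℤ.+ + ρ s x
x≤β+ρ α≤β (below x≤α)      = ℤₚ.≤-trans (ℤₚ.≤-trans x≤α α≤β) (ℤₚ.i≤i+j _ _)
x≤β+ρ α≤β (inside _ x≤β)   = ℤₚ.≤-trans x≤β (ℤₚ.i≤i+j _ _)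
x≤β+ρ {β = β} {x} α≤β (above β≤x) =
  ℤₚ.≤-reflexive (sym (trans
    (cong (λ e → β ℤ.+ e) (trans (cong +_ (ρ-sym β x)) (+ρ β≤x))) (x+[y-x]≡y β x)))

-- Each coordinate overshoots its interval by at most its own distance. Single-coordinate bounds use
-- that one distance is at most `c`, the diagonal bounds that their sum is.
inOct-intro : ∀ {α β γ δ x y s r c} → α ℤ.≤ β → γ ℤ.≤ δ → Clamp α β x s → Clamp γ δ y r →
              ρ s x + ρ r y ≤ c → InOct α β γ δ (+ c) (x , y)
inOct-intro {α} {β} {γ} {δ} {x} {y} {s} {r} {c} α≤β γ≤δ cx cy e+f≤c =
  (≤-transfer (ℤₚ.+-mono-≤ lx e≤c) (lower₁ α x e c') ,
   ≤-transfer (ℤₚ.+-mono-≤ ux e≤c) (upper₁ β x e c')) ,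
  (≤-transfer (ℤₚ.+-mono-≤ ly f≤c) (lower₁ γ y f c') ,
   ≤-transfer (ℤₚ.+-mono-≤ uy f≤c) (upper₁ δ y f c')) ,
  (≤-transfer (ℤₚ.+-mono-≤ (ℤₚ.+-mono-≤ lx ly) e+f≤c') (sum-lower α γ x y e f c') ,
   ≤-transfer (ℤₚ.+-mono-≤ (ℤₚ.+-mono-≤ ux uy) e+f≤c') (sum-upper β δ x y e f c')) ,
  (≤-transfer (ℤₚ.+-mono-≤ (ℤₚ.+-mono-≤ lx uy) e+f≤c') (diff-lower α δ x y e f c') ,
   ≤-transfer (ℤₚ.+-mono-≤ (ℤₚ.+-mono-≤ ux ly) e+f≤c') (diff-upper β γ x y e f c'))
  where
  e f c' : ℤ
  e = + ρ s x
  f = + ρ r y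
  c' = + c
  lx : α ℤ.≤ x ℤ.+ e
  lx = α≤x+ρ α≤β cx
  ux : x ℤ.≤ β ℤ.+ e
  ux = x≤β+ρ α≤β cx
  ly : γ ℤ.≤ y ℤ.+ f
  ly = α≤x+ρ γ≤δ cy
  uy : y ℤ.≤ δ ℤ.+ f
  uy = x≤β+ρ γ≤δ cy
  e+f≤c' : e ℤ.+ f ℤ.≤ c'
  e+f≤c' = ℤ.+≤+ e+f≤c
  e≤c : e ℤ.≤ c'
  e≤c = ℤ.+≤+ (ℕₚ.≤-trans (ℕₚ.m≤m+n _ (ρ r y)) e+f≤c)
  f≤c : f ℤ.≤ c'
  f≤c = ℤ.+≤+ (ℕₚ.≤-trans (ℕₚ.m≤n+m _ (ρ s x)) e+f≤c)
  lower₁ : ∀ α x e c → x ℤ.+ e ℤ.+ c ℤ.- (α ℤ.+ e) ≡ x ℤ.- (α ℤ.- c)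
  lower₁ = ℤR.solve-∀
  upper₁ : ∀ β x e c → β ℤ.+ e ℤ.+ c ℤ.- (x ℤ.+ e) ≡ β ℤ.+ c ℤ.- x
  upper₁ = ℤR.solve-∀
  sum-lower : ∀ α γ x y e f c → (x ℤ.+ e) ℤ.+ (y ℤ.+ f) ℤ.+ c ℤ.- (α ℤ.+ γ ℤ.+ (e ℤ.+ f))
                              ≡ x ℤ.+ y ℤ.- (α ℤ.+ γ ℤ.- c)
  sum-lower = ℤR.solve-∀
  sum-upper : ∀ β δ x y e f c → (β ℤ.+ e) ℤ.+ (δ ℤ.+ f) ℤ.+ c ℤ.- (x ℤ.+ y ℤ.+ (e ℤ.+ f))
                              ≡ β ℤ.+ δ ℤ.+ c ℤ.- (x ℤ.+ y)
  sum-upper = ℤR.solve-∀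
  diff-lower : ∀ α δ x y e f c → (x ℤ.+ e) ℤ.+ (δ ℤ.+ f) ℤ.+ c ℤ.- (α ℤ.+ y ℤ.+ (e ℤ.+ f))
                               ≡ x ℤ.- y ℤ.- (α ℤ.- δ ℤ.- c)
  diff-lower = ℤR.solve-∀
  diff-upper : ∀ β γ x y e f c → (β ℤ.+ e) ℤ.+ (y ℤ.+ f) ℤ.+ c ℤ.- (x ℤ.+ γ ℤ.+ (e ℤ.+ f))
                               ≡ β ℤ.- γ ℤ.+ c ℤ.- (x ℤ.- y)
  diff-upper = ℤR.solve-∀

-- Each pair of positions relative to the two intervals makes one of the eight
-- inequalities of the octagon tight.
inOct-elim : ∀ {α β γ δ x y s r c} → Clamp α β x s → Clamp γ δ y r →
             InOct α β γ δ (+ c) (x , y) → ρ s x + ρ r y ≤ c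
inOct-elim {α} {β} {γ} {δ} {x} {y} {s} {r} {c} cx cy
  ((x≥ , x≤) , (y≥ , y≤) , (x+y≥ , x+y≤) , (x-y≥ , x-y≤)) = bound cx cy
  where
  c' : ℤ
  c' = + c
  conclude : ∀ {e f i j} → + ρ s x ≡ e → + ρ r y ≡ f → i ℤ.≤ j → j ℤ.- i ≡ c' ℤ.- (e ℤ.+ f) →
             ρ s x + ρ r y ≤ c
  conclude refl refl i≤j eq = ℤₚ.drop‿+≤+ (≤-transfer i≤j eq)
  ρ0 : ∀ u → + ρ u u ≡ 0ℤ
  ρ0 u = cong +_ (ρ-refl u)
  ρ≥ : ∀ {u v} → u ℤ.≤ v → + ρ u v ≡ v ℤ.- u
  ρ≥ {u} {v} u≤v = trans (cong +_ (ρ-sym u v)) (+ρ u≤v)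
  bb : ∀ x y α γ c → x ℤ.+ y ℤ.- (α ℤ.+ γ ℤ.- c) ≡ c ℤ.- ((α ℤ.- x) ℤ.+ (γ ℤ.- y))
  bb = ℤR.solve-∀
  bi : ∀ x α c → x ℤ.- (α ℤ.- c) ≡ c ℤ.- ((α ℤ.- x) ℤ.+ 0ℤ)
  bi = ℤR.solve-∀
  ba : ∀ x y α δ c → x ℤ.- y ℤ.- (α ℤ.- δ ℤ.- c) ≡ c ℤ.- ((α ℤ.- x) ℤ.+ (y ℤ.- δ))
  ba = ℤR.solve-∀
  ib : ∀ y γ c → y ℤ.- (γ ℤ.- c) ≡ c ℤ.- (0ℤ ℤ.+ (γ ℤ.- y))
  ib = ℤR.solve-∀
  ii : ∀ c → c ℤ.- 0ℤ ≡ c ℤ.- (0ℤ ℤ.+ 0ℤ)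
  ii = ℤR.solve-∀
  ia : ∀ y δ c → δ ℤ.+ c ℤ.- y ≡ c ℤ.- (0ℤ ℤ.+ (y ℤ.- δ))
  ia = ℤR.solve-∀
  ab : ∀ x y β γ c → β ℤ.- γ ℤ.+ c ℤ.- (x ℤ.- y) ≡ c ℤ.- ((x ℤ.- β) ℤ.+ (γ ℤ.- y))
  ab = ℤR.solve-∀
  ai : ∀ x β c → β ℤ.+ c ℤ.- x ≡ c ℤ.- ((x ℤ.- β) ℤ.+ 0ℤ)
  ai = ℤR.solve-∀
  aa : ∀ x y β δ c → β ℤ.+ δ ℤ.+ c ℤ.- (x ℤ.+ y) ≡ c ℤ.- ((x ℤ.- β) ℤ.+ (y ℤ.- δ))
  aa = ℤR.solve-∀
  bound : Clamp α β x s → Clamp γ δ y r → ρ s x + ρ r y ≤ c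
  bound (below p)    (below q)    = conclude (+ρ p) (+ρ q) x+y≥ (bb x y α γ c')
  bound (below p)    (inside _ _) = conclude (+ρ p) (ρ0 y) x≥ (bi x α c')
  bound (below p)    (above q)    = conclude (+ρ p) (ρ≥ q) x-y≥ (ba x y α δ c')
  bound (inside _ _) (below q)    = conclude (ρ0 x) (+ρ q) y≥ (ib y γ c')
  -- Inside the rectangle both distances vanish, and the claim is the nonnegativity of `c`.
  bound (inside _ _) (inside _ _) = conclude (ρ0 x) (ρ0 y) (ℤ.+≤+ {n = c} z≤n) (ii c')
  bound (inside _ _) (above q)    = conclude (ρ0 x) (ρ≥ q) y≤ (ia y δ c')
  bound (above p)    (below q)    = conclude (ρ≥ p) (+ρ q) x-y≤ (ab x y β γ c')
  bound (above p)    (inside _ _) = conclude (ρ≥ p) (ρ0 y) x≤ (ai x β c')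
  bound (above p)    (above q)    = conclude (ρ≥ p) (ρ≥ q) x+y≤ (aa x y β δ c')

-- Combining the two coordinates

module _ {a b c z : Point} {α β γ δ s₁ s₂ : ℤ}
  (X : Median (xc a) (xc b) (xc c) α β) (Y : Median (yc a) (yc b) (yc c) γ δ)
  (X-clamp : Clamp α β (xc z) s₁) (Y-clamp : Clamp γ δ (yc z) s₂) where

  private
    module X = Median X
    module Y = Median Y
    m s : Point
    m = X.m , Y.m
    s = s₁ , s₂

  starLength : Point → ℕ
  starLength p = d p a + (d p b + d p c)

  starLength-split : ∀ p → starLength p ≡ star (xc p) (xc a) (xc b) (xc c) + star (yc p) (yc a) (yc b) (yc c)
  starLength-split p = split (ρ (xc p) (xc a)) (ρ (xc p) (xc b)) (ρ (xc p) (xc c))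
                             (ρ (yc p) (yc a)) (ρ (yc p) (yc b)) (ρ (yc p) (yc c))
    where
    split : ∀ i j k i' j' k' → (i + i') + ((j + j') + (k + k')) ≡ (i + (j + k)) + (i' + (j' + k'))
    split = ℕR.solve-∀

  starLength-min : ∀ p → starLength m ≤ starLength p
  starLength-min p = subst₂ _≤_ (sym (starLength-split m)) (sym (starLength-split p))
    (ℕₚ.+-mono-≤ (X.star-min (xc p)) (Y.star-min (yc p)))

  -- L₁-lengths are sums over the coordinates, so the two one-dimensional bridge bounds, taken at
  -- the coordinates of the same `q` and `p`, simply add.
  bridgeLength-min : ∀ q p → starLength m + d s z ≤ (d q z + d q a) + d q p + (d p b + d p c)
  bridgeLength-min q p = begin
    starLength m + d s z
      ≡⟨ cong (_+ d s z) (starLength-split m) ⟩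
    starX + starY + d s z
      ≡⟨ +-interchange starX starY (ρ (xc s) (xc z)) (ρ (yc s) (yc z)) ⟩
    (starX + ρ (xc s) (xc z)) + (starY + ρ (yc s) (yc z))
      ≤⟨ ℕₚ.+-mono-≤ (X.bridge-min X-clamp (xc q) (xc p))
                     (Y.bridge-min Y-clamp (yc q) (yc p)) ⟩
    bridge (xc q) (xc p) (xc z) (xc a) (xc b) (xc c) + bridge (yc q) (yc p) (yc z) (yc a) (yc b) (yc c)
      ≡⟨ split (ρ (xc q) (xc z)) (ρ (xc q) (xc a)) (ρ (xc q) (xc p)) (ρ (xc p) (xc b)) (ρ (xc p) (xc c))
               (ρ (yc q) (yc z)) (ρ (yc q) (yc a)) (ρ (yc q) (yc p)) (ρ (yc p) (yc b)) (ρ (yc p) (yc c)) ⟨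
    (d q z + d q a) + d q p + (d p b + d p c) ∎
    where
    open ℕₚ.≤-Reasoning
    starX starY : ℕ
    starX = star X.m (xc a) (xc b) (xc c)
    starY = star Y.m (yc a) (yc b) (yc c)
    split : ∀ i j k l n i' j' k' l' n' →
            ((i + i') + (j + j')) + (k + k') + ((l + l') + (n + n')) ≡
            ((i + j) + k + (l + n)) + ((i' + j') + k' + (l' + n'))
    split = ℕR.solve-∀

  starLength≤tristance : ∀ {t} → IsTristance a b c t → starLength m ≤ t
  starLength≤tristance ((vs , T , len , a∈ ∷ b∈ ∷ c∈ ∷ []) , _) with tripod T a∈ b∈ c∈
  ... | p , lt = ℕₚ.≤-trans (starLength-min p) (s≤s⁻¹ (ℕₚ.≤-trans lt len))

  tristance≤starLength : ∀ {t} → IsTristance a b c t → t ≤ starLength m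
  -- Placing both `s` and `z` at `m` collapses the hub tree to the star of `m`.
  tristance≤starLength {t} (_ , least) = subst (t ≤_) eq (least _ (treeWithin-map
    (λ { (a∈ ∷ b∈ ∷ c∈ ∷ _ ∷ []) → a∈ ∷ b∈ ∷ c∈ ∷ [] }) (hubTree m m a b c m)))
    where
    simplify : ∀ i j k → 0 + i + j + k + 0 ≡ i + (j + k)
    simplify = ℕR.solve-∀
    eq : d m m + d m a + d m b + d m c + d m m ≡ starLength m
    eq = trans (cong (λ o → o + d m a + d m b + d m c + o) (d-refl m)) (simplify (d m a) (d m b) (d m c))

  quartet⇒inOct : ∀ {t k} → IsTristance a b c t → Quartet (suc k) z a b c → InOct α β γ δ (+ (k ∸ t)) z
  quartet⇒inOct {t} {k} tri (q , p , lt) =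
    inOct-intro X.α≤β Y.α≤β X-clamp Y-clamp
      -- The ball condition `d s z ≤ k ∸ t` is proved in the form `d s z + t ≤ k`, which avoids
      -- truncated subtraction.
      (ℕₚ.m+n≤o⇒m≤o∸n (d s z) (begin
        d s z + t             ≡⟨ ℕₚ.+-comm (d s z) t ⟩
        t + d s z             ≤⟨ ℕₚ.+-monoˡ-≤ (d s z) (tristance≤starLength tri) ⟩
        starLength m + d s z  ≤⟨ bridgeLength-min q p ⟩
        (d q z + d q a) + d q p + (d p b + d p c) ≤⟨ s≤s⁻¹ lt ⟩
        k                     ∎))
    where open ℕₚ.≤-Reasoning

  inOct⇒quadristance : ∀ {t k} → IsTristance a b c t → t ≤ k → InOct α β γ δ (+ (k ∸ t)) z →
                       Quadristance≤ a b c z k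
  inOct⇒quadristance {t} {k} tri t≤k oct = treeWithin-mono bound (hubTree m s a b c z)
    where
    open ℕₚ.≤-Reasoning
    -- Since `s` lies in the rectangle spanned by `a` and `m`, the detour through `s` costs nothing.
    arm : d m s + d s a ≡ d m a
    arm = trans (+-interchange (ρ (xc m) (xc s)) (ρ (yc m) (yc s)) (ρ (xc s) (xc a)) (ρ (yc s) (yc a)))
      (cong₂ _+_ (X.between X-clamp) (Y.between Y-clamp))
    bound : d m s + d s a + d m b + d m c + d s z ≤ k
    bound = begin
      d m s + d s a + d m b + d m c + d s z ≡⟨ cong (λ i → i + d m b + d m c + d s z) arm ⟩
      d m a + d m b + d m c + d s z         ≡⟨ cong (_+ d s z) (ℕₚ.+-assoc (d m a) (d m b) (d m c)) ⟩
      starLength m + d s z                  ≤⟨ ℕₚ.+-mono-≤ (starLength≤tristance tri)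
                                                 (inOct-elim X-clamp Y-clamp oct) ⟩
      t + (k ∸ t)                           ≡⟨ ℕₚ.m+[n∸m]≡n t≤k ⟩
      k                                     ∎

-- The three octagons and their union

quartet⇒oct : ∀ a b c z {t k} → IsTristance a b c t → Quartet (suc k) z a b c →
              Oct a b c (+ (k ∸ t)) z
quartet⇒oct a b c z = quartet⇒inOct (median (xc a) (xc b) (xc c)) (median (yc a) (yc b) (yc c))
  (proj₂ (clamp _ _ (xc z))) (proj₂ (clamp _ _ (yc z)))

oct⇒quadristance : ∀ a b c z {t k} → IsTristance a b c t → t ≤ k → Oct a b c (+ (k ∸ t)) z →
                   Quadristance≤ a b c z k
oct⇒quadristance a b c z = inOct⇒quadristance
  (median (xc a) (xc b) (xc c)) (median (yc a) (yc b) (yc c))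
  (proj₂ (clamp _ _ (xc z))) (proj₂ (clamp _ _ (yc z)))

tristance-swap : ∀ {a b c t} → IsTristance a b c t → IsTristance b a c t
tristance-swap (tree , least) = treeWithin-map swap tree , λ k → least k ∘ treeWithin-map swap
  where
  swap : ∀ {a b c vs} → All (_∈ vs) (a ∷ b ∷ c ∷ []) → All (_∈ vs) (b ∷ a ∷ c ∷ [])
  swap (a∈ ∷ b∈ ∷ c∈ ∷ []) = b∈ ∷ a∈ ∷ c∈ ∷ []

tristance-rotate : ∀ {a b c t} → IsTristance a b c t → IsTristance c a b t
tristance-rotate (tree , least) =
  -- Minimality pulls trees back along the inverse rotation, which is the square of the rotation.
  treeWithin-map rotate tree , λ k → least k ∘ treeWithin-map (rotate ∘ rotate)
  where
  rotate : ∀ {a b c vs} → All (_∈ vs) (a ∷ b ∷ c ∷ []) → All (_∈ vs) (c ∷ a ∷ b ∷ [])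
  rotate (a∈ ∷ b∈ ∷ c∈ ∷ []) = c∈ ∷ a∈ ∷ b∈ ∷ []

theorem36 : (z₁ z₂ z₃ : Point) → z₁ ≢ z₂ → z₁ ≢ z₃ → z₂ ≢ z₃ →
    (t : ℕ) → IsTristance z₁ z₂ z₃ t →
    (d : ℕ) → t ≤ d →
    (z : Point) →
    (Quadristance≤ z₁ z₂ z₃ z d →
    Oct z₁ z₂ z₃ (+ (d ∸ t)) z ⊎ Oct z₂ z₁ z₃ (+ (d ∸ t)) z ⊎ Oct z₃ z₁ z₂ (+ (d ∸ t)) z)
    × (Oct z₁ z₂ z₃ (+ (d ∸ t)) z ⊎ Oct z₂ z₁ z₃ (+ (d ∸ t)) z ⊎ Oct z₃ z₁ z₂ (+ (d ∸ t)) z →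
    Quadristance≤ z₁ z₂ z₃ z d)
theorem36 z₁ z₂ z₃ _ _ _ t tri k t≤k z = necessary , sufficient
  where
  tri₂ : IsTristance z₂ z₁ z₃ t
  tri₂ = tristance-swap tri
  tri₃ : IsTristance z₃ z₁ z₂ t
  tri₃ = tristance-rotate tri
  enough : ∀ {n a b c e} → n ≤ suc k → Quartet n a b c e → Quartet (suc k) a b c e
  enough n≤ (q , p , lt) = q , p , ℕₚ.≤-trans lt n≤
  necessary : Quadristance≤ z₁ z₂ z₃ z k →
    Oct z₁ z₂ z₃ (+ (k ∸ t)) z ⊎ Oct z₂ z₁ z₃ (+ (k ∸ t)) z ⊎ Oct z₃ z₁ z₂ (+ (k ∸ t)) z
  -- The point paired with `z` in the quartet is the first point of the octagon obtained.
  necessary (vs , T , len , z₁∈ ∷ z₂∈ ∷ z₃∈ ∷ z∈ ∷ []) with anyQuartet T z∈ z₁∈ z₂∈ z₃∈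
  ... | inj₁ Q        = inj₁ (quartet⇒oct z₁ z₂ z₃ z tri (enough len Q))
  ... | inj₂ (inj₁ Q) = inj₂ (inj₁ (quartet⇒oct z₂ z₁ z₃ z tri₂ (enough len Q)))
  ... | inj₂ (inj₂ Q) = inj₂ (inj₂ (quartet⇒oct z₃ z₁ z₂ z tri₃ (enough len Q)))
  sufficient : Oct z₁ z₂ z₃ (+ (k ∸ t)) z ⊎ Oct z₂ z₁ z₃ (+ (k ∸ t)) z ⊎ Oct z₃ z₁ z₂ (+ (k ∸ t)) z →
    Quadristance≤ z₁ z₂ z₃ z k
  sufficient (inj₁ O) = oct⇒quadristance z₁ z₂ z₃ z tri t≤k O
  sufficient (inj₂ (inj₁ O)) = treeWithin-map
    (λ { (z₂∈ ∷ z₁∈ ∷ z₃∈ ∷ z∈ ∷ []) → z₁∈ ∷ z₂∈ ∷ z₃∈ ∷ z∈ ∷ [] })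
    (oct⇒quadristance z₂ z₁ z₃ z tri₂ t≤k O)
  sufficient (inj₂ (inj₂ O)) = treeWithin-map
    (λ { (z₃∈ ∷ z₁∈ ∷ z₂∈ ∷ z∈ ∷ []) → z₁∈ ∷ z₂∈ ∷ z₃∈ ∷ z∈ ∷ [] })
    (oct⇒quadristance z₃ z₁ z₂ z tri₃ t≤k O)
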